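{- Let $r\ge-1$ be an integer and $m\ge1$. Let $\beta_r(m,q)=\sum q^{|\pi|}$, summed over all partitions $\pi$ with $n$ copies of $n$ having exactly $m$ parts, whose lexicographically smallest part is of the form $i_i$ for some $i\ge1$, and such that, with parts listed in ascending lexicographic order, the weighted difference of each part and the preceding one is exactly $r$. Then $$\beta_r(m,q)=\frac{q^{m^2+r\binom m2}}{(q;q^2)_m}.$$
   Context: $M=\{m_i: 1\le i\le m\}$; a partition with $n$ copies of $n$ is a finite multiset of elements of $M$, and $|\pi|$ is the sum of the values (first entries) of its parts. Lexicographic order: $m_i>n_j$ iff $m>n$, or $m=n$ and $i>j$. Weighted difference $((m_i-n_j))=m-n-i-j$; "successive weighted difference" of consecutive parts $n_j\le m_i$ in ascending order means $((m_i-n_j))$. $(a;q)_m=\prod_{j=0}^{m-1}(1-aq^j)$. -}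

module Defs where

open import Data.Bool using (if_then_else_)
open import Data.Fin using (Fin; toℕ)
open import Data.Integer as ℤ using (ℤ; +_; 0ℤ; 1ℤ)
import Data.Integer.Properties as ℤ
open import Data.List using (List; []; _∷_; allFin; cartesianProductWith; concat; filter; head; length; map; upTo)
import Data.List.Membership.Propositional as List
open import Data.List.Membership.Propositional.Properties
  using (∈-allFin; ∈-cartesianProductWith⁺; ∈-concat⁺′; ∈-filter⁺; ∈-filter⁻; ∈-map⁺; ∈-map⁻; ∈-upTo⁺)
open import Data.List.Relation.Unary.All as All using ([]; _∷_)
import Data.List.Relation.Unary.All.Properties as All
open import Data.List.Relation.Unary.AllPairs as AllPairs using ([]; _∷_)
import Data.List.Relation.Unary.AllPairs.Properties as AllPairs
open import Data.List.Relation.Unary.Any using (here)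
open import Data.List.Relation.Unary.Linked using (Linked; linked?)
open import Data.List.Relation.Unary.Unique.Propositional using (Unique)
import Data.List.Relation.Unary.Unique.Propositional.Properties as Unique
import Data.Maybe.Relation.Unary.Any as Maybe
open import Data.Nat as ℕ using (ℕ; zero; suc; _∸_; _≤_; _<_)
open import Data.Nat.ListAction using (sum)
import Data.Nat.Properties as ℕ
open import Data.Product using (Σ; _×_; _,_; proj₁; proj₂)
open import Data.Product.Relation.Binary.Lex.Strict using (×-Lex; ×-decidable)
open import Function using (_∘_)
open import Function.Bundles using (_⇔_; mk⇔)
open import Level using (0ℓ)
open import Relation.Binary using (Rel; Decidable)
open import Relation.Binary.PropositionalEquality
open import Relation.Nullary using (Dec; does; _×-dec_)
open import Relation.Nullary.Decidable using (map′)

open import Algebra.Properties.Monoid.Sum ℤ.+-0-monoid using (sum-syntax)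

-- The pair (m , k) is the part m_i with i = k + 1, so that 1 ≤ i ≤ m.
Part : Set
Part = Σ ℕ Fin

value index : Part → ℕ
value (m , _) = m
index (_ , k) = suc (toℕ k)

_≤ₗ_ : Rel Part 0ℓ
p ≤ₗ p′ = ×-Lex _≡_ _<_ _≤_ (value p , index p) (value p′ , index p′)

_≤ₗ?_ : Decidable _≤ₗ_
p ≤ₗ? p′ = ×-decidable ℕ._≟_ ℕ._<?_ ℕ._≤?_ (value p , index p) (value p′ , index p′)

-- ((m_i − n_j)) = m − n − i − j, a possibly negative integer.
⟪_−_⟫ : Part → Part → ℤ
⟪ p − p′ ⟫ = + value p ℤ.- + value p′ ℤ.- + index p ℤ.- + index p′

∣_∣ : List Part → ℕ
∣ π ∣ = sum (map value π)

-- A finite multiset of parts is represented by the list of its elements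
-- in ascending lexicographic order, so its head is its smallest part.
record IsCounted (r : ℤ) (m : ℕ) (π : List Part) : Set where
  constructor isCounted
  field
    ascending   : Linked _≤ₗ_ π
    parts       : length π ≡ m
    smallest    : Maybe.Any (λ p → value p ≡ index p) (head π)
    differences : Linked (λ p p′ → ⟪ p′ − p ⟫ ≡ r) π

isCounted? : ∀ r m π → Dec (IsCounted r m π)
isCounted? r m π = map′
  (λ (a , l , s , d) → isCounted a l s d)
  (λ (isCounted a l s d) → a , l , s , d)
  (linked? _≤ₗ?_ π
    ×-dec length π ℕ.≟ m
    ×-dec Maybe.dec (λ p → value p ℕ.≟ index p) (head π)
    ×-dec linked? (λ p p′ → ⟪ p′ − p ⟫ ℤ.≟ r) π)

partsOfValue : ℕ → List Part
partsOfValue v = map (v ,_) (allFin v)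

partsUpTo : ℕ → List Part
partsUpTo n = concat (map partsOfValue (upTo (suc n)))

listsOfLength : ℕ → List Part → List (List Part)
listsOfLength zero    ps = [] ∷ []
listsOfLength (suc m) ps = cartesianProductWith _∷_ ps (listsOfLength m ps)

-- See ∈-counted and counted-unique below: every counted π with ∣ π ∣ ≡ n
-- occurs in this list exactly once, and nothing else does.
counted : ℤ → ℕ → ℕ → List (List Part)
counted r m n =
  filter (λ π → isCounted? r m π ×-dec ∣ π ∣ ℕ.≟ n) (listsOfLength m (partsUpTo n))

private
  ∈-partsUpTo : ∀ {n} p → value p ≤ n → p List.∈ partsUpTo n
  ∈-partsUpTo (v , k) v≤n =
    ∈-concat⁺′ (∈-map⁺ (v ,_) (∈-allFin k)) (∈-map⁺ partsOfValue (∈-upTo⁺ (ℕ.s≤s v≤n)))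

  ∈-listsOfLength : ∀ {n} π → ∣ π ∣ ≤ n → π List.∈ listsOfLength (length π) (partsUpTo n)
  ∈-listsOfLength []      _ = here refl
  ∈-listsOfLength (p ∷ π) h = ∈-cartesianProductWith⁺ _∷_
    (∈-partsUpTo p (ℕ.≤-trans (ℕ.m≤m+n (value p) ∣ π ∣) h))
    (∈-listsOfLength π (ℕ.≤-trans (ℕ.m≤n+m ∣ π ∣ (value p)) h))

  ∈-partsOfValue : ∀ {v p} → p List.∈ partsOfValue v → value p ≡ v
  ∈-partsOfValue p∈ with _ , _ , refl ← ∈-map⁻ (_ ,_) p∈ = refl

  partsUpTo-unique : ∀ n → Unique (partsUpTo n)
  partsUpTo-unique n = Unique.concat⁺
    (All.map⁺ (All.universal (λ v → Unique.map⁺ (λ { refl → refl }) (Unique.allFin⁺ v)) _))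
    (AllPairs.map⁺ (AllPairs.map
      (λ v≢w {_} (p∈v , p∈w) → v≢w (trans (sym (∈-partsOfValue p∈v)) (∈-partsOfValue p∈w)))
      (Unique.upTo⁺ (suc n))))

  listsOfLength-unique : ∀ m {ps} → Unique ps → Unique (listsOfLength m ps)
  listsOfLength-unique zero    u = [] ∷ []
  listsOfLength-unique (suc m) u =
    Unique.cartesianProductWith⁺ _∷_ (λ { refl → refl , refl }) u (listsOfLength-unique m u)

∈-counted : ∀ r m n π → π List.∈ counted r m n ⇔ (IsCounted r m π × ∣ π ∣ ≡ n)
∈-counted r m n π = mk⇔ (proj₂ ∘ ∈-filter⁻ P? {xs = listsOfLength m (partsUpTo n)}) from
  where
  P? = λ π → isCounted? r m π ×-dec ∣ π ∣ ℕ.≟ n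
  from : IsCounted r m π × ∣ π ∣ ≡ n → π List.∈ counted r m n
  from h@(c , w) = ∈-filter⁺ P?
    (subst (λ l → π List.∈ listsOfLength l (partsUpTo n)) (IsCounted.parts c)
      (∈-listsOfLength π (ℕ.≤-reflexive w)))
    h

counted-unique : ∀ r m n → Unique (counted r m n)
counted-unique r m n = Unique.filter⁺ _ (listsOfLength-unique m (partsUpTo-unique n))

-- The n-th entry is the coefficient of q^n.
PowerSeries : Set
PowerSeries = ℕ → ℤ

infixl 6 _⊖_
infixl 7 _⊛_ _⊘_
infixr 8 _↑_

-- q to the power e.  For e < 0 this is the zero series.
q^ : ℤ → PowerSeries
q^ e n = if does (+ n ℤ.≟ e) then 1ℤ else 0ℤ

q 𝟏 : PowerSeries
q = q^ 1ℤ
𝟏 = q^ 0ℤ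

_⊖_ _⊛_ : PowerSeries → PowerSeries → PowerSeries
(f ⊖ g) n = f n ℤ.- g n
(f ⊛ g) n = ∑[ k < suc n ] (f (toℕ k) ℤ.* g (n ∸ toℕ k))

_↑_ : PowerSeries → ℕ → PowerSeries
f ↑ zero  = 𝟏
f ↑ suc k = f ⊛ (f ↑ k)

-- Quotient by a series g with constant term 1, by long division:
-- f = f₀ g + q f′ with f′ = remainder f g, so f / g = f₀ + q (f′ / g).
remainder : PowerSeries → PowerSeries → PowerSeries
remainder f g n = f (suc n) ℤ.- f 0 ℤ.* g (suc n)

_⊘_ : PowerSeries → PowerSeries → PowerSeries
(f ⊘ g) zero    = f 0
(f ⊘ g) (suc n) = (remainder f g ⊘ g) n

⊘-⊛ : ∀ f g → g 0 ≡ 1ℤ → (f ⊘ g) ⊛ g ≗ f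
⊘-⊛ f g g₀ zero    = trans (ℤ.+-identityʳ _) (trans (cong (ℤ._*_ (f 0)) g₀) (ℤ.*-identityʳ (f 0)))
⊘-⊛ f g g₀ (suc n) = begin
  a ℤ.+ ((remainder f g ⊘ g) ⊛ g) n ≡⟨ cong (ℤ._+_ a) (⊘-⊛ (remainder f g) g g₀ n) ⟩
  a ℤ.+ (f (suc n) ℤ.- a)           ≡⟨ ℤ.+-comm a _ ⟩
  (f (suc n) ℤ.- a) ℤ.+ a           ≡⟨ ℤ.+-assoc (f (suc n)) (ℤ.- a) a ⟩
  f (suc n) ℤ.+ (ℤ.- a ℤ.+ a)       ≡⟨ cong (ℤ._+_ (f (suc n))) (ℤ.+-inverseˡ a) ⟩
  f (suc n) ℤ.+ 0ℤ                  ≡⟨ ℤ.+-identityʳ _ ⟩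
  f (suc n)                         ∎
  where
  open ≡-Reasoning
  a = f 0 ℤ.* g (suc n)

-- (a ; b)_m = (1 − a) (1 − a b) ⋯ (1 − a b^(m−1))
qPochhammer : PowerSeries → PowerSeries → ℕ → PowerSeries
qPochhammer a b zero    = 𝟏
qPochhammer a b (suc m) = qPochhammer a b m ⊛ (𝟏 ⊖ a ⊛ b ↑ m)

qPochhammer-constant : ∀ a b m → a 0 ≡ 0ℤ → qPochhammer a b m 0 ≡ 1ℤ
qPochhammer-constant a b zero    a₀ = refl
qPochhammer-constant a b (suc m) a₀
  rewrite qPochhammer-constant a b m a₀ | a₀ = refl

β : ℤ → ℕ → PowerSeries
β r m n = + length (counted r m n)

{-# OPTIONS --safe #-}
-- Write r = s − 1 and call n − i the excess of a part n_i, so the smallest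
-- part has excess 0.  If a part has excess d and index j + 1, the weighted
-- difference condition says exactly that the next part has excess
-- d + 2j + 1 + s.  Hence a partition counted by β is determined by its m
-- indices, which are arbitrary.  Increasing the index of the part followed by k
-- others by one raises ∣ π ∣ by 2k + 1: one for its own value and two for each
-- of the k others.  So ∣ π ∣ is the constant m² + r C(m,2), attained when all
-- indices are 1, plus a sum of multiples of 1, 3, …, 2m − 1, and such sums are
-- enumerated by 1/(q;q²)_m: either 2m − 1 does not occur, or one copy of it can
-- be removed, which is the recurrence 1/(q;q²)_m = 1/(q;q²)_(m−1) + q^(2m−1)/(q;q²)_m.
module Submission where

open import Defs
open import Data.Integer using (ℤ; +_; -1ℤ; _+_; _*_; _≤_)
open import Data.Nat as ℕ using (ℕ; _^_)
open import Data.Nat.Combinatorics using (_C_)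
open import Relation.Binary.PropositionalEquality using (_≗_)

open import Data.Empty using (⊥; ⊥-elim)
open import Data.Fin using (Fin; toℕ; fromℕ; _↑ˡ_)
open import Data.Fin.Properties using (toℕ-fromℕ; toℕ-injective; toℕ-↑ˡ)
open import Data.Integer using (-_; -[1+_]; 0ℤ; 1ℤ; -≤-; -≤+)
import Data.Integer.Properties as ℤ
import Data.Integer.Tactic.RingSolver as ℤ-Solver
open import Data.List using (List; []; _∷_; _++_; length; map)
open import Data.List.Membership.Propositional using (_∈_)
open import Data.List.Membership.Propositional.Properties using (∈-map⁺; ∈-map⁻; ∈-++⁺ˡ; ∈-++⁺ʳ; ∈-++⁻)
open import Data.List.Membership.Propositional.Properties.WithK using (unique∧set⇒bag)
open import Data.List.Properties using (length-map; length-++; ∷-injective)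
open import Data.List.Relation.Binary.BagAndSetEquality using (∼bag⇒↭)
open import Data.List.Relation.Binary.Permutation.Propositional.Properties using (↭-length)
open import Data.List.Relation.Unary.All using ([])
open import Data.List.Relation.Unary.AllPairs using ([]; _∷_)
open import Data.List.Relation.Unary.Any using (here)
open import Data.List.Relation.Unary.Linked as Linked using (Linked; [-]; _∷_)
open import Data.List.Relation.Unary.Unique.Propositional using (Unique)
import Data.List.Relation.Unary.Unique.Propositional.Properties as Unique
import Data.Maybe.Relation.Unary.Any as Maybe
open import Data.Nat using (zero; suc; z≤n; s≤s)
open import Data.Nat.Combinatorics using (nC1≡n; nCk+nC[k+1]≡[n+1]C[k+1])
open import Data.Nat.Induction using (Acc; acc; <-wellFounded)
import Data.Nat.Properties as ℕ
import Data.Nat.Tactic.RingSolver as ℕ-Solver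
open import Data.Product using (∃; _×_; _,_; proj₂)
open import Data.Sum as Sum using (_⊎_; inj₁; inj₂)
open import Data.Vec using (Vec; []; _∷_)
open import Function using (_∘_; _⇔_; mk⇔; Equivalence)
open import Function.Definitions using (Injective)
open import Relation.Binary.PropositionalEquality
  using (_≡_; refl; sym; trans; cong; cong₂; subst; module ≡-Reasoning)
open import Relation.Nullary using (¬_)

open ≡-Reasoning

-- Power series

-- By computation, `(f ⊛ g) (suc n)` is `f 0 * g (suc n) + ((f ∘ suc) ⊛ g) n`. The inductions on
-- coefficients below all rest on this unfolding.
⊛-cong : ∀ {f f′ g g′} → f ≗ f′ → g ≗ g′ → f ⊛ g ≗ f′ ⊛ g′
⊛-cong f≗ g≗ zero    = cong (_+ 0ℤ) (cong₂ _*_ (f≗ 0) (g≗ 0))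
⊛-cong f≗ g≗ (suc n) = cong₂ _+_ (cong₂ _*_ (f≗ 0) (g≗ (suc n))) (⊛-cong (f≗ ∘ suc) g≗ n)

-- The left factor has the shape of the tail of a product, `(f ⊛ g) ∘ suc`, which is where `⊛-assoc`
-- applies it.
⊛-linear : ∀ a f g h → (λ n → a * f n + g n) ⊛ h ≗ λ n → a * (f ⊛ h) n + (g ⊛ h) n
⊛-linear a f g h zero    = identity a (f 0) (g 0) (h 0)
  where
  identity : ∀ a x y z → (a * x + y) * z + 0ℤ ≡ a * (x * z + 0ℤ) + (y * z + 0ℤ)
  identity = ℤ-Solver.solve-∀
⊛-linear a f g h (suc n) =
  trans (cong (_+_ ((a * f 0 + g 0) * h (suc n))) (⊛-linear a (f ∘ suc) (g ∘ suc) h n))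
        (identity a (f 0) (g 0) (h (suc n)) (((f ∘ suc) ⊛ h) n) (((g ∘ suc) ⊛ h) n))
  where
  identity : ∀ a x y z u v → (a * x + y) * z + (a * u + v) ≡ a * (x * z + u) + (y * z + v)
  identity = ℤ-Solver.solve-∀

⊛-distribʳ-⊖ : ∀ f g h → (f ⊖ g) ⊛ h ≗ (f ⊛ h) ⊖ (g ⊛ h)
⊛-distribʳ-⊖ f g h zero    = identity (f 0) (g 0) (h 0)
  where
  identity : ∀ x y z → (x + - y) * z + 0ℤ ≡ (x * z + 0ℤ) + - (y * z + 0ℤ)
  identity = ℤ-Solver.solve-∀
⊛-distribʳ-⊖ f g h (suc n) =
  trans (cong (_+_ ((f 0 + - g 0) * h (suc n))) (⊛-distribʳ-⊖ (f ∘ suc) (g ∘ suc) h n))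
        (identity (f 0) (g 0) (h (suc n)) (((f ∘ suc) ⊛ h) n) (((g ∘ suc) ⊛ h) n))
  where
  identity : ∀ x y z u v → (x + - y) * z + (u + - v) ≡ (x * z + u) + - (y * z + v)
  identity = ℤ-Solver.solve-∀

⊛-assoc : ∀ f g h → (f ⊛ g) ⊛ h ≗ f ⊛ (g ⊛ h)
⊛-assoc f g h zero    = identity (f 0) (g 0) (h 0)
  where
  identity : ∀ x y z → (x * y + 0ℤ) * z + 0ℤ ≡ x * (y * z + 0ℤ) + 0ℤ
  identity = ℤ-Solver.solve-∀
⊛-assoc f g h (suc n) = begin
  (f 0 * g 0 + 0ℤ) * h (suc n) + (((f ⊛ g) ∘ suc) ⊛ h) n
    ≡⟨ cong (_+_ ((f 0 * g 0 + 0ℤ) * h (suc n))) (⊛-linear (f 0) (g ∘ suc) ((f ∘ suc) ⊛ g) h n) ⟩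
  (f 0 * g 0 + 0ℤ) * h (suc n) + (f 0 * ((g ∘ suc) ⊛ h) n + (((f ∘ suc) ⊛ g) ⊛ h) n)
    ≡⟨ cong (λ z → (f 0 * g 0 + 0ℤ) * h (suc n) + (f 0 * ((g ∘ suc) ⊛ h) n + z)) (⊛-assoc (f ∘ suc) g h n) ⟩
  (f 0 * g 0 + 0ℤ) * h (suc n) + (f 0 * ((g ∘ suc) ⊛ h) n + ((f ∘ suc) ⊛ (g ⊛ h)) n)
    ≡⟨ identity (f 0) (g 0) (h (suc n)) (((g ∘ suc) ⊛ h) n) (((f ∘ suc) ⊛ (g ⊛ h)) n) ⟩
  f 0 * (g ⊛ h) (suc n) + ((f ∘ suc) ⊛ (g ⊛ h)) n ∎
  where
  identity : ∀ x y z u v → (x * y + 0ℤ) * z + (x * u + v) ≡ x * (y * z + u) + v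
  identity = ℤ-Solver.solve-∀

-- Products unfold only along the left factor, so swapping is used to peel off first the term with
-- `f 0`, then the one with `g 0`. Two peelings call for two base cases.
⊛-comm : ∀ f g → f ⊛ g ≗ g ⊛ f
⊛-comm f g zero          = cong (_+ 0ℤ) (ℤ.*-comm (f 0) (g 0))
⊛-comm f g (suc zero)    = identity (f 0) (f 1) (g 0) (g 1)
  where
  identity : ∀ x x′ y y′ → x * y′ + (x′ * y + 0ℤ) ≡ y * x′ + (y′ * x + 0ℤ)
  identity = ℤ-Solver.solve-∀
⊛-comm f g (suc (suc n)) = begin
  x + (f′ ⊛ g) (suc n)      ≡⟨ cong (_+_ x) (⊛-comm f′ g (suc n)) ⟩
  x + (y + (g′ ⊛ f′) n)     ≡⟨ cong (λ z → x + (y + z)) (⊛-comm g′ f′ n) ⟩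
  x + (y + (f′ ⊛ g′) n)     ≡⟨ identity x y ((f′ ⊛ g′) n) ⟩
  y + (x + (f′ ⊛ g′) n)     ≡⟨ cong (_+_ y) (⊛-comm g′ f (suc n)) ⟨
  y + (g′ ⊛ f) (suc n)      ∎
  where
  f′ = f ∘ suc
  g′ = g ∘ suc
  x = f 0 * g (2 ℕ.+ n)
  y = g 0 * f (2 ℕ.+ n)
  identity : ∀ x y z → x + (y + z) ≡ y + (x + z)
  identity = ℤ-Solver.solve-∀

-- One step of long division: the constant terms of `h` and `f` agree, and the tail of `h` solves
-- the same equation for `remainder f g`.
⊘-unique : ∀ f g h → g 0 ≡ 1ℤ → h ⊛ g ≗ f → h ≗ f ⊘ g
⊘-unique f g h g₀ hg≗f = go
  where
  h₀ : h 0 ≡ f 0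
  h₀ = begin
    h 0             ≡⟨ ℤ.*-identityʳ (h 0) ⟨
    h 0 * 1ℤ        ≡⟨ cong (h 0 *_) g₀ ⟨
    h 0 * g 0       ≡⟨ ℤ.+-identityʳ _ ⟨
    h 0 * g 0 + 0ℤ  ≡⟨ hg≗f 0 ⟩
    f 0             ∎
  identity : ∀ x y → y ≡ (x + y) + - x
  identity = ℤ-Solver.solve-∀
  tail : (h ∘ suc) ⊛ g ≗ remainder f g
  tail n = begin
    ((h ∘ suc) ⊛ g) n                                             ≡⟨ identity (h 0 * g (suc n)) _ ⟩
    (h 0 * g (suc n) + ((h ∘ suc) ⊛ g) n) + - (h 0 * g (suc n))  ≡⟨ cong₂ (λ x y → x + - (y * g (suc n))) (hg≗f (suc n)) h₀ ⟩
    remainder f g n                                               ∎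
  go : h ≗ f ⊘ g
  go zero    = h₀
  go (suc n) = ⊘-unique (remainder f g) g (h ∘ suc) g₀ tail n

⊘-cong : ∀ {f f′} g → f ≗ f′ → f ⊘ g ≗ f′ ⊘ g
⊘-cong g f≗ zero    = f≗ 0
⊘-cong g f≗ (suc n) = ⊘-cong g (λ k → cong₂ (λ x y → x + - (y * g (suc k))) (f≗ (suc k)) (f≗ 0)) n

-- Multiplication by powers of q as shifts of coefficients

shift : ℕ → PowerSeries → PowerSeries
shift zero    f n       = f n
shift (suc a) f zero    = 0ℤ
shift (suc a) f (suc n) = shift a f n

shift-cong : ∀ a {f g} → f ≗ g → shift a f ≗ shift a g
shift-cong zero    f≗g n       = f≗g n
shift-cong (suc a) f≗g zero    = refl
shift-cong (suc a) f≗g (suc n) = shift-cong a f≗g n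

shift-shift : ∀ a b f → shift a (shift b f) ≗ shift (a ℕ.+ b) f
shift-shift zero    b f n       = refl
shift-shift (suc a) b f zero    = refl
shift-shift (suc a) b f (suc n) = shift-shift a b f n

-- As long as the exponent is positive the constant term is 0, so taking the remainder merely lowers
-- the exponent by one.
q^-⊘ : ∀ e g → q^ (+ e) ⊘ g ≗ shift e (𝟏 ⊘ g)
q^-⊘ zero    g n       = refl
q^-⊘ (suc e) g zero    = refl
q^-⊘ (suc e) g (suc n) = trans (⊘-cong g (λ k → ℤ.+-identityʳ _) n) (q^-⊘ e g n)

-- Describes q^a by its action on series, so that exponents add under products by associativity. As
-- a record, its type determines `g` and `a`.
record ActsAsShift (g : PowerSeries) (a : ℕ) : Set where
  field
    ⊛≗shift : ∀ f → g ⊛ f ≗ shift a f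

open ActsAsShift

0⊛ : ∀ {g} → (∀ n → g n ≡ 0ℤ) → ∀ f n → (g ⊛ f) n ≡ 0ℤ
0⊛ g≡0 f zero    rewrite g≡0 0 = refl
0⊛ g≡0 f (suc n) rewrite g≡0 0 = trans (ℤ.+-identityˡ _) (0⊛ (g≡0 ∘ suc) f n)

𝟏-acts : ActsAsShift 𝟏 0
𝟏-acts .⊛≗shift f zero    = trans (ℤ.+-identityʳ _) (ℤ.*-identityˡ (f 0))
𝟏-acts .⊛≗shift f (suc n) = begin
  1ℤ * f (suc n) + ((𝟏 ∘ suc) ⊛ f) n  ≡⟨ cong₂ _+_ (ℤ.*-identityˡ (f (suc n))) (0⊛ {𝟏 ∘ suc} (λ _ → refl) f n) ⟩
  f (suc n) + 0ℤ                      ≡⟨ ℤ.+-identityʳ _ ⟩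
  f (suc n)                           ∎

q-acts : ActsAsShift q 1
q-acts .⊛≗shift f zero    = refl
q-acts .⊛≗shift f (suc n) = trans (ℤ.+-identityˡ _) (⊛≗shift 𝟏-acts f n)

⊛-acts : ∀ {g h a b} → ActsAsShift g a → ActsAsShift h b → ActsAsShift (g ⊛ h) (a ℕ.+ b)
⊛-acts {g} {h} {a} {b} g-acts h-acts .⊛≗shift f n = begin
  ((g ⊛ h) ⊛ f) n        ≡⟨ ⊛-assoc g h f n ⟩
  (g ⊛ (h ⊛ f)) n        ≡⟨ ⊛≗shift g-acts (h ⊛ f) n ⟩
  shift a (h ⊛ f) n      ≡⟨ shift-cong a (⊛≗shift h-acts f) n ⟩
  shift a (shift b f) n  ≡⟨ shift-shift a b f n ⟩
  shift (a ℕ.+ b) f n    ∎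

↑-acts : ∀ {g a} → ActsAsShift g a → ∀ k → ActsAsShift (g ↑ k) (k ℕ.* a)
↑-acts g-acts zero    = 𝟏-acts
↑-acts g-acts (suc k) = ⊛-acts g-acts (↑-acts g-acts k)

-- The reciprocal of (q;q²)_m and its recurrence

1/qPochhammer : ℕ → PowerSeries
1/qPochhammer m = 𝟏 ⊘ qPochhammer q (q ↑ 2) m

1/qPochhammer-zero : 1/qPochhammer 0 ≗ 𝟏
1/qPochhammer-zero n = sym (⊘-unique 𝟏 𝟏 𝟏 refl (⊛≗shift 𝟏-acts 𝟏) n)

-- With `u` = 1 - q^(2m+1), the denominator for m + 1 is `P ⊛ u`. Hence `c ⊛ u` is inverse to `P`
-- and equals `1/qPochhammer m` by uniqueness of quotients, while it is also `c` minus its shift.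
1/qPochhammer-suc : ∀ m n → 1/qPochhammer (suc m) n ≡
  1/qPochhammer m n + shift (1 ℕ.+ m ℕ.* 2) (1/qPochhammer (suc m)) n
1/qPochhammer-suc m n = begin
  c n                                   ≡⟨ identity (c n) _ ⟩
  (c n + - shift a c n) + shift a c n   ≡⟨ cong (_+ shift a c n) (cu≗ n) ⟨
  (c ⊛ u) n + shift a c n               ≡⟨ cong (_+ shift a c n) (⊘-unique 𝟏 P (c ⊛ u) (qPochhammer-constant q (q ↑ 2) m refl) cuP≗𝟏 n) ⟩
  1/qPochhammer m n + shift a c n       ∎
  where
  a = 1 ℕ.+ m ℕ.* 2
  c = 1/qPochhammer (suc m)
  P = qPochhammer q (q ↑ 2) m
  x = q ⊛ (q ↑ 2) ↑ m
  u = 𝟏 ⊖ x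
  identity : ∀ x y → x ≡ (x + - y) + y
  identity = ℤ-Solver.solve-∀
  cuP≗𝟏 : (c ⊛ u) ⊛ P ≗ 𝟏
  cuP≗𝟏 k = begin
    ((c ⊛ u) ⊛ P) k  ≡⟨ ⊛-assoc c u P k ⟩
    (c ⊛ (u ⊛ P)) k  ≡⟨ ⊛-cong {c} (λ _ → refl) (⊛-comm u P) k ⟩
    (c ⊛ (P ⊛ u)) k  ≡⟨ ⊘-⊛ 𝟏 (P ⊛ u) (qPochhammer-constant q (q ↑ 2) (suc m) refl) k ⟩
    𝟏 k              ∎
  x-acts : ActsAsShift x a
  x-acts = ⊛-acts q-acts (↑-acts (↑-acts q-acts 2) m)
  cu≗ : ∀ k → (c ⊛ u) k ≡ c k + - shift a c k
  cu≗ k = begin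
    (c ⊛ u) k                    ≡⟨ ⊛-comm c u k ⟩
    (u ⊛ c) k                    ≡⟨ ⊛-distribʳ-⊖ 𝟏 x c k ⟩
    (𝟏 ⊛ c) k + - (x ⊛ c) k      ≡⟨ cong₂ (λ y z → y + - z) (⊛≗shift 𝟏-acts c k) (⊛≗shift x-acts c k) ⟩
    c k + - shift a c k          ∎

-- Counting

-- A duplicate-free enumeration of `P`. The size is an integer so that coefficients of power series
-- can be used for it directly.
record Count {A : Set} (P : A → Set) (z : ℤ) : Set where
  field
    elements : List A
    unique   : Unique elements
    complete : ∀ {x} → P x → x ∈ elements
    sound    : ∀ {x} → x ∈ elements → P x
    size     : + length elements ≡ z

open Count

module _ {A : Set} where

  -- Duplicate-free lists with the same members are permutations of each other.
  count-unique : ∀ {P : A → Set} {y z} → Count P y → Count P z → y ≡ z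
  count-unique c d = trans (sym (size c)) (trans (cong +_ (↭-length (∼bag⇒↭
    (unique∧set⇒bag (unique c) (unique d)
      (mk⇔ (complete d ∘ sound c) (complete c ∘ sound d)))))) (size d))

  count-∅ : ∀ {P : A → Set} → (∀ {x} → ¬ P x) → Count P 0ℤ
  count-∅ ¬P = record
    { elements = []
    ; unique   = []
    ; complete = λ Px → ⊥-elim (¬P Px)
    ; sound    = λ ()
    ; size     = refl
    }

  count-⇔ : ∀ {P Q : A → Set} {z} → (∀ {x} → P x ⇔ Q x) → Count P z → Count Q z
  count-⇔ P⇔Q c = record
    { elements = elements c
    ; unique   = unique c
    ; complete = complete c ∘ Equivalence.from P⇔Q
    ; sound    = Equivalence.to P⇔Q ∘ sound c
    ; size     = size c
    }

  count-⊎ : ∀ {P Q : A → Set} {y z} → (∀ {x} → P x → Q x → ⊥) →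
    Count P y → Count Q z → Count (λ x → P x ⊎ Q x) (y + z)
  count-⊎ disjoint c d = record
    { elements = elements c ++ elements d
    ; unique   = Unique.++⁺ (unique c) (unique d) (λ (x∈c , x∈d) → disjoint (sound c x∈c) (sound d x∈d))
    ; complete = λ where
        (inj₁ Px) → ∈-++⁺ˡ (complete c Px)
        (inj₂ Qx) → ∈-++⁺ʳ (elements c) (complete d Qx)
    ; sound    = λ x∈ → Sum.map (sound c) (sound d) (∈-++⁻ (elements c) x∈)
    ; size     = trans (cong +_ (length-++ (elements c))) (cong₂ _+_ (size c) (size d))
    }

count-image : ∀ {A B : Set} {P : A → Set} {z} (f : A → B) → Injective _≡_ _≡_ f →
  Count P z → Count (λ y → ∃ λ x → P x × f x ≡ y) z
count-image f f-injective c = record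
  { elements = map f (elements c)
  ; unique   = Unique.map⁺ f-injective (unique c)
  ; complete = λ { (x , Px , refl) → ∈-map⁺ f (complete c Px) }
  ; sound    = λ y∈ → let x , x∈ , y≡ = ∈-map⁻ f y∈ in x , sound c x∈ , sym y≡
  ; size     = trans (cong +_ (length-map f (elements c))) (size c)
  }

-- The hypothesis is asked only for `k` with `a ℕ.+ k ≡ n`, so that `count-weight` can call itself
-- there with a proof that `k` is smaller than `n`.
count-shift : ∀ {A : Set} (w : A → ℕ) (f : PowerSeries) a {n} →
  (∀ k → a ℕ.+ k ≡ n → Count (λ x → w x ≡ k) (f k)) →
  Count (λ x → a ℕ.+ w x ≡ n) (shift a f n)
count-shift w f zero            c = c _ refl
count-shift w f (suc a) {zero}  c = count-∅ λ ()
count-shift w f (suc a) {suc n} c =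
  count-⇔ (mk⇔ (cong suc) ℕ.suc-injective) (count-shift w f a (λ k → c k ∘ cong suc))

-- The entries are the indices minus 1, that of the smallest part first.
weight : ∀ {m} → Vec ℕ m → ℕ
weight         []       = 0
weight {suc m} (j ∷ js) = j ℕ.* (1 ℕ.+ m ℕ.* 2) ℕ.+ weight js

increment : ∀ {m} → Vec ℕ (suc m) → Vec ℕ (suc m)
increment (j ∷ js) = suc j ∷ js

weight-increment : ∀ {m} (js : Vec ℕ (suc m)) → weight (increment js) ≡ 1 ℕ.+ m ℕ.* 2 ℕ.+ weight js
weight-increment {m} (j ∷ js) = ℕ.+-assoc (1 ℕ.+ m ℕ.* 2) (j ℕ.* (1 ℕ.+ m ℕ.* 2)) (weight js)

-- Lexicographic induction on (m, n). If the first entry is 0, dropping it lowers m and keeps n;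
-- otherwise decrementing it keeps m and lowers n by 2m - 1 ≥ 1.
count-weight : ∀ m n → Count (λ (js : Vec ℕ m) → weight js ≡ n) (1/qPochhammer m n)
count-weight m n = go m n (<-wellFounded n)
  where
  base : ∀ n → Count (λ (js : Vec ℕ 0) → weight js ≡ n) (𝟏 n)
  base zero = record
    { elements = [] ∷ []
    ; unique   = [] ∷ []
    ; complete = λ { {[]} _ → here refl }
    ; sound    = λ { (here refl) → refl }
    ; size     = refl
    }
  base (suc n) = count-∅ λ { {[]} () }

  go : ∀ m n → Acc ℕ._<_ n → Count (λ (js : Vec ℕ m) → weight js ≡ n) (1/qPochhammer m n)
  go zero    n _        = subst (Count _) (sym (1/qPochhammer-zero n)) (base n)
  go (suc m) n (acc rs) = subst (Count _) (sym (1/qPochhammer-suc m n))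
    (count-⇔ (mk⇔ to from) (count-⊎ (λ { (_ , _ , refl) (_ ∷ _ , _ , ()) })
      (count-image (0 ∷_) (λ { refl → refl }) (go m n (<-wellFounded n)))
      (count-image increment (λ { {_ ∷ _} {_ ∷ _} refl → refl })
        (count-shift weight (1/qPochhammer (suc m)) (1 ℕ.+ m ℕ.* 2) λ k a+k≡n →
          go (suc m) k (rs (subst (k ℕ.<_) a+k≡n (s≤s (ℕ.m≤n+m k (m ℕ.* 2)))))))))
    where
    Split : Vec ℕ (suc m) → Set
    Split js = (∃ λ js′ → weight js′ ≡ n × 0 ∷ js′ ≡ js) ⊎
               (∃ λ js′ → 1 ℕ.+ m ℕ.* 2 ℕ.+ weight js′ ≡ n × increment js′ ≡ js)
    to : ∀ {js} → Split js → weight js ≡ n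
    to (inj₁ (_ , w , refl))   = w
    to (inj₂ (js , w , refl))  = trans (weight-increment js) w
    from : ∀ {js} → weight js ≡ n → Split js
    from {zero  ∷ js} w = inj₁ (js , w , refl)
    from {suc j ∷ js} w = inj₂ (j ∷ js , trans (sym (weight-increment (j ∷ js))) w , refl)

-- Partitions with weighted differences s − 1

-- The part of excess d and index j + 1.
partAt : ℕ → ℕ → Part
partAt d j = suc j ℕ.+ d , fromℕ j ↑ˡ d

index-partAt : ∀ d j → index (partAt d j) ≡ suc j
index-partAt d j = cong suc (trans (toℕ-↑ˡ (fromℕ j) d) (toℕ-fromℕ j))

partAt-injective : ∀ d {j j′} → partAt d j ≡ partAt d j′ → j ≡ j′
partAt-injective d {j} {j′} eq = ℕ.suc-injective
  (trans (sym (index-partAt d j)) (trans (cong index eq) (index-partAt d j′)))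

partAt-surjective : ∀ d p → value p ≡ index p ℕ.+ d → ∃ λ j → partAt d j ≡ p
partAt-surjective d (v , k) = go v k (toℕ k) refl
  where
  -- The variable `j` stands for `toℕ k`: the type of `k` mentions `v`, so the equation for `v` can
  -- be matched with `refl` only once its right side is free of `k`.
  go : ∀ v (k : Fin v) j → toℕ k ≡ j → v ≡ suc (toℕ k) ℕ.+ d → ∃ λ j → partAt d j ≡ (v , k)
  go v k j k≡j v≡ with refl ← trans v≡ (cong (λ i → suc i ℕ.+ d) k≡j) =
    j , cong (_ ,_) (toℕ-injective (trans (ℕ.suc-injective (index-partAt d j)) (sym k≡j)))

module _ (s : ℕ) where

  -- The weighted difference equation solved for the excess of the next part: value + index + s - 1.
  -- Since `toℕ (proj₂ p)` is already the index minus 1, this is a natural number for every s ≥ 0.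
  nextExcess : Part → ℕ
  nextExcess p = toℕ (proj₂ p) ℕ.+ value p ℕ.+ s

  Successive : Part → Part → Set
  Successive p p′ = value p′ ≡ index p′ ℕ.+ nextExcess p

  -- Values strictly increase: the excess of `p′` is at least `value p`, and its index is at least
  -- 1.
  successive⇒ascending : ∀ {p p′} → Successive p p′ → p ≤ₗ p′
  successive⇒ascending {v , k} {v′ , k′} v′≡ = inj₁ (subst (v ℕ.<_) (sym v′≡)
    (s≤s (ℕ.≤-trans (ℕ.m≤n+m v (toℕ k)) (ℕ.≤-trans (ℕ.m≤m+n _ s) (ℕ.m≤n+m _ (toℕ k′))))))

  successive⇔difference : ∀ {p p′} → Successive p p′ ⇔ (⟪ p′ − p ⟫ ≡ -1ℤ + + s)
  successive⇔difference {v , k} {v′ , k′} = mk⇔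
    (λ h → trans (cong (λ x → x + - (+ v) + - (+ suc (toℕ k′)) + - (+ suc (toℕ k))) (cong +_ h))
                 (to (+ v) (+ suc (toℕ k′)) (+ toℕ k) (+ s)))
    (λ h → ℤ.+-injective (trans (from (+ v′) (+ v) (+ suc (toℕ k′)) (+ toℕ k))
      (trans (cong (_+ (+ v + + suc (toℕ k′) + + suc (toℕ k))) h)
             (collect (+ v) (+ suc (toℕ k′)) (+ toℕ k) (+ s)))))
    where
    to : ∀ y z w s → (z + (w + y + s)) + - y + - z + - (1ℤ + w) ≡ -1ℤ + s
    to = ℤ-Solver.solve-∀
    from : ∀ x y z w → x ≡ (x + - y + - z + - (1ℤ + w)) + (y + z + (1ℤ + w))
    from = ℤ-Solver.solve-∀
    collect : ∀ y z w s → (-1ℤ + s) + (y + z + (1ℤ + w)) ≡ z + (w + y + s)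
    collect = ℤ-Solver.solve-∀

  -- The numerical argument is the excess imposed on the first part; the vector supplies the freely
  -- chosen indices.
  build : ∀ {m} → ℕ → Vec ℕ m → List Part
  build d []       = []
  build d (j ∷ js) = partAt d j ∷ build (nextExcess (partAt d j)) js

  build-length : ∀ {m} d (js : Vec ℕ m) → length (build d js) ≡ m
  build-length d []       = refl
  build-length d (j ∷ js) = cong suc (build-length _ js)

  build-successive : ∀ {m} d (js : Vec ℕ m) → Linked Successive (build d js)
  build-successive d []           = Linked.[]
  build-successive d (j ∷ [])     = [-]
  build-successive d (j ∷ i ∷ js) =
    cong (ℕ._+ d′) (sym (index-partAt d′ i)) ∷ build-successive d′ (i ∷ js)
    where d′ = nextExcess (partAt d j)

  build-injective : ∀ {m} d {js js′ : Vec ℕ m} → build d js ≡ build d js′ → js ≡ js′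
  build-injective d {[]}     {[]}       eq = refl
  build-injective d {j ∷ js} {j′ ∷ js′} eq
    with head-eq , tail-eq ← ∷-injective eq
    -- The first indices must be identified before the tails are compared, because they determine
    -- the excess at which the tails start.
    with refl ← partAt-injective d {j} {j′} head-eq
    = cong (j ∷_) (build-injective _ tail-eq)

  -- `Successive p p′` is literally the hypothesis on the excess of the first part, restated for the
  -- tail.
  build-surjective : ∀ d p π → value p ≡ index p ℕ.+ d → Linked Successive (p ∷ π) →
    ∃ λ (js : Vec ℕ (suc (length π))) → build d js ≡ p ∷ π
  build-surjective d p π h l with partAt-surjective d p h
  build-surjective d p []       h l       | j , refl = j ∷ [] , refl
  build-surjective d p (p′ ∷ π) h (x ∷ l) | j , refl
    with js , eq ← build-surjective (nextExcess p) p′ π x l = j ∷ js , cong (p ∷_) eq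

  -- The size reached when all indices are 1 and the first excess is 0. A new smallest part
  -- contributes its value 1 and raises the excess of each of the `m` later parts by `suc s`.
  minimum : ℕ → ℕ
  minimum zero    = 0
  minimum (suc m) = minimum m ℕ.+ (1 ℕ.+ m ℕ.* suc s)

  -- Stated for any initial excess `d` to let the induction pass to the tail: every later excess
  -- contains `d` once, which gives the term `m ℕ.* d`.
  ∣build∣ : ∀ {m} d (js : Vec ℕ m) → ∣ build d js ∣ ≡ m ℕ.* d ℕ.+ (minimum m ℕ.+ weight js)
  ∣build∣         d []       = refl
  ∣build∣ {suc m} d (j ∷ js) = begin
    suc j ℕ.+ d ℕ.+ ∣ build d′ js ∣
      ≡⟨ cong (suc j ℕ.+ d ℕ.+_) (∣build∣ d′ js) ⟩
    suc j ℕ.+ d ℕ.+ (m ℕ.* d′ ℕ.+ (minimum m ℕ.+ weight js))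
      ≡⟨ cong (λ i → suc j ℕ.+ d ℕ.+ (m ℕ.* (i ℕ.+ (suc j ℕ.+ d) ℕ.+ s) ℕ.+ (minimum m ℕ.+ weight js)))
              (ℕ.suc-injective (index-partAt d j)) ⟩
    suc j ℕ.+ d ℕ.+ (m ℕ.* (j ℕ.+ (suc j ℕ.+ d) ℕ.+ s) ℕ.+ (minimum m ℕ.+ weight js))
      ≡⟨ identity j d m s (minimum m) (weight js) ⟩
    suc m ℕ.* d ℕ.+ (minimum (suc m) ℕ.+ weight (j ∷ js)) ∎
    where
    d′ = nextExcess (partAt d j)
    identity : ∀ j d m s e w →
      suc j ℕ.+ d ℕ.+ (m ℕ.* (j ℕ.+ (suc j ℕ.+ d) ℕ.+ s) ℕ.+ (e ℕ.+ w)) ≡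
      suc m ℕ.* d ℕ.+ (e ℕ.+ (1 ℕ.+ m ℕ.* suc s) ℕ.+ (j ℕ.* (1 ℕ.+ m ℕ.* 2) ℕ.+ w))
    identity = ℕ-Solver.solve-∀

  -- The increment 1 + m(1 + s) equals (2m + 1) + (s - 1)m, where 2m + 1 is the growth of the square
  -- and m that of the binomial coefficient.
  minimum-closed : ∀ m → + minimum m ≡ + (m ^ 2) + (-1ℤ + + s) * + (m C 2)
  minimum-closed zero    = sym (cong (_+_ 0ℤ) (ℤ.*-zeroʳ (-1ℤ + + s)))
  minimum-closed (suc m) = begin
    + minimum m + (1ℤ + + (m ℕ.* suc s))
      ≡⟨ cong₂ (λ x y → x + (1ℤ + y)) (minimum-closed m) (ℤ.pos-* m (suc s)) ⟩
    + (m ^ 2) + (-1ℤ + + s) * + (m C 2) + (1ℤ + + m * (1ℤ + + s))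
      ≡⟨ cong (λ x → x + (-1ℤ + + s) * + (m C 2) + (1ℤ + + m * (1ℤ + + s))) (square m) ⟩
    + m * + m + (-1ℤ + + s) * + (m C 2) + (1ℤ + + m * (1ℤ + + s))
      ≡⟨ identity (+ m) (+ s) (+ (m C 2)) ⟩
    (1ℤ + + m) * (1ℤ + + m) + (-1ℤ + + s) * (+ m + + (m C 2))
      ≡⟨ cong₂ (λ x y → x + (-1ℤ + + s) * y) (square (suc m)) (cong +_ choose) ⟨
    + (suc m ^ 2) + (-1ℤ + + s) * + (suc m C 2) ∎
    where
    square : ∀ m → + (m ^ 2) ≡ + m * + m
    square m = trans (cong +_ (cong (m ℕ.*_) (ℕ.*-identityʳ m))) (ℤ.pos-* m m)
    choose : suc m C 2 ≡ m ℕ.+ m C 2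
    choose = trans (sym (nCk+nC[k+1]≡[n+1]C[k+1] m 1)) (cong (ℕ._+ m C 2) (nC1≡n m))
    identity : ∀ m s c → m * m + (-1ℤ + s) * c + (1ℤ + m * (1ℤ + s)) ≡
      (1ℤ + m) * (1ℤ + m) + (-1ℤ + s) * (m + c)
    identity = ℤ-Solver.solve-∀

  -- Counted partitions enumerated by index vectors

  isCounted⇔build : ∀ m {π} → IsCounted (-1ℤ + + s) (suc m) π ⇔ ∃ λ (js : Vec ℕ (suc m)) → build 0 js ≡ π
  isCounted⇔build m = mk⇔ to from
    where
    to : ∀ {π} → IsCounted (-1ℤ + + s) (suc m) π → ∃ λ (js : Vec ℕ (suc m)) → build 0 js ≡ π
    to {p ∷ π} (isCounted _ refl (Maybe.just v≡i) l) =
      -- A smallest part of the form i_i is one of excess 0.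
      build-surjective 0 p π (trans v≡i (sym (ℕ.+-identityʳ _)))
        (Linked.map (λ {p} {p′} → Equivalence.from (successive⇔difference {p} {p′})) l)
    from : ∀ {π} → (∃ λ (js : Vec ℕ (suc m)) → build 0 js ≡ π) → IsCounted (-1ℤ + + s) (suc m) π
    from (js@(j ∷ _) , refl) = isCounted
      (Linked.map (λ {p} {p′} → successive⇒ascending {p} {p′}) (build-successive 0 js))
      (build-length 0 js)
      (Maybe.just (trans (ℕ.+-identityʳ _) (sym (index-partAt 0 j))))
      (Linked.map (λ {p} {p′} → Equivalence.to (successive⇔difference {p} {p′})) (build-successive 0 js))

  count-isCounted : ∀ m n → Count (λ π → IsCounted (-1ℤ + + s) (suc m) π × ∣ π ∣ ≡ n)
    (shift (minimum (suc m)) (1/qPochhammer (suc m)) n)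
  count-isCounted m n = count-⇔ (mk⇔ to from)
    (count-image (build 0) (build-injective 0)
      (count-shift weight (1/qPochhammer (suc m)) (minimum (suc m)) (λ k _ → count-weight (suc m) k)))
    where
    total : (js : Vec ℕ (suc m)) → ∣ build 0 js ∣ ≡ minimum (suc m) ℕ.+ weight js
    total js = trans (∣build∣ 0 js) (cong (ℕ._+ (minimum (suc m) ℕ.+ weight js)) (ℕ.*-zeroʳ m))
    Built : List Part → Set
    Built π = ∃ λ (js : Vec ℕ (suc m)) → minimum (suc m) ℕ.+ weight js ≡ n × build 0 js ≡ π
    to : ∀ {π} → Built π → IsCounted (-1ℤ + + s) (suc m) π × ∣ π ∣ ≡ n
    to (js , w , refl) = Equivalence.from (isCounted⇔build m) (js , refl) , trans (total js) w
    from : ∀ {π} → IsCounted (-1ℤ + + s) (suc m) π × ∣ π ∣ ≡ n → Built π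
    from (h , w) = let js , eq = Equivalence.to (isCounted⇔build m) h in
      js , trans (sym (total js)) (trans (cong ∣_∣ eq) w) , eq

  β-formula : ∀ m n → β (-1ℤ + + s) (suc m) n ≡
    (q^ (+ (suc m ^ 2) + (-1ℤ + + s) * + (suc m C 2)) ⊘ qPochhammer q (q ↑ 2) (suc m)) n
  β-formula m n = begin
    β (-1ℤ + + s) (suc m) n
      ≡⟨ count-unique count-counted (count-isCounted m n) ⟩
    shift (minimum (suc m)) (1/qPochhammer (suc m)) n
      ≡⟨ q^-⊘ (minimum (suc m)) P n ⟨
    (q^ (+ minimum (suc m)) ⊘ P) n
      ≡⟨ cong (λ e → (q^ e ⊘ P) n) (minimum-closed (suc m)) ⟩
    (q^ (+ (suc m ^ 2) + (-1ℤ + + s) * + (suc m C 2)) ⊘ P) n ∎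
    where
    P = qPochhammer q (q ↑ 2) (suc m)
    count-counted : Count (λ π → IsCounted (-1ℤ + + s) (suc m) π × ∣ π ∣ ≡ n) (β (-1ℤ + + s) (suc m) n)
    count-counted = record
      { elements = counted (-1ℤ + + s) (suc m) n
      ; unique   = counted-unique (-1ℤ + + s) (suc m) n
      ; complete = Equivalence.from (∈-counted (-1ℤ + + s) (suc m) n _)
      ; sound    = Equivalence.to (∈-counted (-1ℤ + + s) (suc m) n _)
      ; size     = refl
      }

theorem20 : (r : ℤ) (m : ℕ) → -1ℤ ≤ r → 1 ℕ.≤ m →
    β r m ≗ q^ (+ (m ^ 2) + r * + (m C 2)) ⊘ qPochhammer q (q ↑ 2) m
-- Here s = r + 1, so r = -1 gives 0 and a nonnegative r gives its successor; `-1ℤ + + suc s`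
-- computes to `+ s`.
theorem20 -[1+ 0 ] (suc m) (-≤- z≤n) _ = β-formula 0 m
theorem20 (+ s)    (suc m) -≤+       _ = β-formula (suc s) m
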